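{- Let $n\in\mathbb{N}$, $n>0$. For every computable abelian group $G$ and every $b\in G$, $b\neq 0$, there is a $k$-coloring of $G$ of PA degree with no pairwise monochromatic solution to $$(x_1-y_1)+\dots+(x_n-y_n)=b,$$ where $$k=\begin{cases}2n & \text{if } 2\mid \mathrm{ord}(b)\text{ or }\mathrm{ord}(b)=\infty,\\ \left\lceil \dfrac{2np}{p-1}\right\rceil & \text{if }\mathrm{ord}(b)\text{ is odd and }p\text{ is the largest prime divisor of }\mathrm{ord}(b).\end{cases}$$
   Context: A computable group is a group whose underlying set and group operations are computable; $\mathrm{ord}(b)$ is the order of $b$ in $G$. A $k$-coloring of $G$ is any map $c:G\to k=\{0,\dots,k-1\}$. A tuple $(x_1,y_1,\dots,x_n,y_n)\in G^{2n}$ is pairwise monochromatic for $c$ if $c(x_i)=c(y_i)$ for all $i=1,\dots,n$; a pairwise monochromatic solution of an equation is a solution that is pairwise monochromatic for $c$. A tree is a set of finite strings closed under initial segments; a binary tree is a tree contained in $2^{<\mathbb{N}}$. A set (or function) $X$ has PA degree if every computable infinite binary tree has an $X$-computable infinite path.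
   Formalization: "A k-coloring of PA degree" is read as: every X of PA degree computes such a k-coloring. The coloring itself need not have PA degree: for G = ℤ, n = 1, b = 1, k = 2 only the two alternating, computable colorings avoid solutions. -}

module Defs where

open import Algebra.Bundles using (AbelianGroup)
open import Algebra.Core using (Op₁; Op₂)
import Algebra.Definitions.RawMonoid as RawMonoidDefinitions
open import Algebra.Structures using (IsAbelianGroup)
open import Data.Bool.Base using (Bool; true; false; T; if_then_else_)
open import Data.Fin.Base using (Fin; toℕ)
open import Data.List.Base using (List; []; _∷_; _++_; applyUpTo)
open import Data.List.Membership.Propositional using (_∉_)
open import Data.Nat.Base using (ℕ; zero; suc; pred; _+_; _*_; _≤_; _<_; _>_; _/_; NonZero)
open import Data.Nat.Divisibility using (_∣_)
open import Data.Nat.Primality using (Prime; prime)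
open import Data.Product.Base using (Σ; ∃; _×_; _,_; proj₁)
open import Data.Vec.Base using (Vec; []; _∷_; lookup)
open import Data.Vec.Functional using (Vector)
open import Data.Vec.Relation.Binary.Pointwise.Inductive using (Pointwise)
open import Function.Base using (_∘_)
open import Level using (0ℓ)
open import Relation.Binary.PropositionalEquality.Core using (_≡_)
open import Relation.Nullary.Negation.Core using (¬_)

data Code : ℕ → Set where
  zero   : ∀ {n} → Code n
  suc    : Code 1
  oracle : Code 1
  proj   : ∀ {n} → Fin n → Code n
  comp   : ∀ {m n} → Code m → Vec (Code n) m → Code n
  rec    : ∀ {n} → Code n → Code (suc (suc n)) → Code (suc n)
  min    : ∀ {n} → Code (suc n) → Code n

infix 4 _⊢_⟨_⟩⇓_

data _⊢_⟨_⟩⇓_ (X : ℕ → ℕ) : ∀ {n} → Code n → Vec ℕ n → ℕ → Set where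
  ⇓zero   : ∀ {n} {xs : Vec ℕ n} → X ⊢ zero ⟨ xs ⟩⇓ 0
  ⇓suc    : ∀ {x} → X ⊢ suc ⟨ x ∷ [] ⟩⇓ suc x
  ⇓oracle : ∀ {x} → X ⊢ oracle ⟨ x ∷ [] ⟩⇓ X x
  ⇓proj   : ∀ {n} {xs : Vec ℕ n} i → X ⊢ proj i ⟨ xs ⟩⇓ lookup xs i
  ⇓comp   : ∀ {m n} {f : Code m} {gs : Vec (Code n) m} {xs ys z} →
            Pointwise (λ g y → X ⊢ g ⟨ xs ⟩⇓ y) gs ys →
            X ⊢ f ⟨ ys ⟩⇓ z →
            X ⊢ comp f gs ⟨ xs ⟩⇓ z
  ⇓rec₀   : ∀ {n} {f : Code n} {g xs y} →
            X ⊢ f ⟨ xs ⟩⇓ y →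
            X ⊢ rec f g ⟨ 0 ∷ xs ⟩⇓ y
  ⇓rec₁   : ∀ {n} {f : Code n} {g xs k y z} →
            X ⊢ rec f g ⟨ k ∷ xs ⟩⇓ y →
            X ⊢ g ⟨ k ∷ y ∷ xs ⟩⇓ z →
            X ⊢ rec f g ⟨ suc k ∷ xs ⟩⇓ z
  ⇓min    : ∀ {n} {f : Code (suc n)} {xs y} →
            X ⊢ f ⟨ y ∷ xs ⟩⇓ 0 →
            (∀ i → i < y → ∃ λ z → X ⊢ f ⟨ i ∷ xs ⟩⇓ suc z) →
            X ⊢ min f ⟨ xs ⟩⇓ y

-- The function taking (encode a) to (output a) is computable in X.  The
-- code need not converge on vectors outside the image of encode.
ComputableIn : (ℕ → ℕ) → {A : Set} {n : ℕ} → (A → Vec ℕ n) → (A → ℕ) → Set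
ComputableIn X {n = n} encode output =
  ∃ λ (e : Code n) → ∀ a → X ⊢ e ⟨ encode a ⟩⇓ output a

-- The constantly zero oracle is the characteristic function of ∅.
Computable : {A : Set} {n : ℕ} → (A → Vec ℕ n) → (A → ℕ) → Set
Computable = ComputableIn (λ _ → 0)

bit : Bool → ℕ
bit b = if b then 1 else 0

-- Bijective base-2 numeration, so every number codes exactly one string.
⌜_⌝ : List Bool → ℕ
⌜ [] ⌝    = 0
⌜ b ∷ σ ⌝ = suc (bit b + 2 * ⌜ σ ⌝)

record ComputableBinaryTree : Set where
  field
    member            : List Bool → Bool
    closed            : ∀ σ τ → T (member (σ ++ τ)) → T (member σ)
    member-computable : Computable (λ σ → ⌜ σ ⌝ ∷ []) (bit ∘ member)

open ComputableBinaryTree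

Infinite : ComputableBinaryTree → Set
Infinite 𝒯 = ∀ (σs : List (List Bool)) → ∃ λ σ → T (member 𝒯 σ) × σ ∉ σs

IsPath : ComputableBinaryTree → (ℕ → Bool) → Set
IsPath 𝒯 f = ∀ m → T (member 𝒯 (applyUpTo f m))

HasPADegree : (ℕ → ℕ) → Set
HasPADegree X = ∀ 𝒯 → Infinite 𝒯 →
  ∃ λ f → IsPath 𝒯 f × ComputableIn X (λ m → m ∷ []) (bit ∘ f)

record ComputableAbelianGroup : Set where
  infixl 6 _⊕_
  field
    domain : ℕ → Bool

  Carrier : Set
  Carrier = Σ ℕ (T ∘ domain)

  field
    _⊕_            : Op₂ Carrier
    0#             : Carrier
    ⊖_             : Op₁ Carrier
    isAbelianGroup : IsAbelianGroup _≡_ _⊕_ 0# ⊖_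

    domain-computable : Computable (λ m → m ∷ []) (bit ∘ domain)
    ⊕-computable      : Computable {A = Carrier × Carrier}
                          (λ (x , y) → proj₁ x ∷ proj₁ y ∷ [])
                          (λ (x , y) → proj₁ (x ⊕ y))
    ⊖-computable      : Computable (λ x → proj₁ x ∷ []) (λ x → proj₁ (⊖ x))

  abelianGroup : AbelianGroup 0ℓ 0ℓ
  abelianGroup = record { isAbelianGroup = isAbelianGroup }

  open AbelianGroup abelianGroup public using (_-_; rawMonoid; commutativeMonoid)
  open RawMonoidDefinitions rawMonoid public using (sum) renaming (_×_ to _·_)

  HasOrder : Carrier → ℕ → Set
  HasOrder b m = m > 0 × m · b ≡ 0# × (∀ j → j > 0 → j · b ≡ 0# → m ≤ j)

  HasInfiniteOrder : Carrier → Set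
  HasInfiniteOrder b = ∀ j → j > 0 → ¬ (j · b ≡ 0#)

  Coloring : ℕ → Set
  Coloring k = Carrier → Fin k

  ColoringComputableIn : (ℕ → ℕ) → ∀ {k} → Coloring k → Set
  ColoringComputableIn X c = ComputableIn X (λ x → proj₁ x ∷ []) (toℕ ∘ c)

  IsSolution : ∀ {n} → Carrier → Vector Carrier n → Vector Carrier n → Set
  IsSolution b x y = sum (λ i → x i - y i) ≡ b

  PairwiseMonochromatic : ∀ {k n} → Coloring k → Vector Carrier n → Vector Carrier n → Set
  PairwiseMonochromatic c x y = ∀ i → c (x i) ≡ c (y i)

IsLargestPrimeDivisor : ℕ → ℕ → Set
IsLargestPrimeDivisor p m = Prime p × p ∣ m × (∀ q → Prime q → q ∣ m → q ≤ p)

⌈_/_⌉ : (a d : ℕ) → .{{NonZero d}} → ℕ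
⌈ a / d ⌉ = (a + pred d) / d

pred-nonZero : ∀ {p} → Prime p → NonZero (pred p)
pred-nonZero {suc (suc _)} _ = _
pred-nonZero {zero} (prime {{()}} _)
pred-nonZero {suc zero} (prime {{()}} _)

module _ (G : ComputableAbelianGroup) where
  open ComputableAbelianGroup G

  -- The graph of the case distinction defining k from n and ord(b).
  data NumberOfColors (n : ℕ) (b : Carrier) : ℕ → Set where
    even-order     : ∀ {m} → HasOrder b m → 2 ∣ m → NumberOfColors n b (2 * n)
    infinite-order : HasInfiniteOrder b → NumberOfColors n b (2 * n)
    odd-order      : ∀ {m p} → HasOrder b m → ¬ (2 ∣ m) →
                     ((p-prime , _) : IsLargestPrimeDivisor p m) →
                     NumberOfColors n b (⌈ 2 * n * p / pred p ⌉ {{pred-nonZero p-prime}})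

  -- "There is a k-coloring of PA degree": every oracle of PA degree computes
  -- one.  The coloring itself cannot be required to have PA degree: on ℤ with
  -- n = 1 and b = 1, each 2-coloring without a pairwise monochromatic solution
  -- alternates and so is computable, and every coloring of a finite group is
  -- computable.
  AvoidingColoringOfPADegree : ℕ → Carrier → ℕ → Set
  AvoidingColoringOfPADegree n b k =
    ∀ X → HasPADegree X →
    ∃ λ (c : Coloring k) →
      ColoringComputableIn X c ×
      ¬ (∃ λ (x : Vector Carrier n) → ∃ λ (y : Vector Carrier n) →
           IsSolution b x y × PairwiseMonochromatic c x y)

{-# OPTIONS --safe #-}
module Submission where

-- A character χ : G → ℚ/ℤ sends x₁ − y₁ + … + xₙ − yₙ to a point at distance less than n/k from 0 as
-- soon as each pair χ(xᵢ), χ(yᵢ) lies in a common half-open arc of length 1/k.  If χ(b) is at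
-- distance at least n/k from 0, colouring x by the arc containing χ(x) therefore admits no pairwise
-- monochromatic solution, and the order of b allows χ(b) = 1/2 or χ(b) = (p − 1)/(2p).
-- Such a character cannot be computed in general, but extending one to finitely many elements is a
-- finite matter, and only its double negation is needed: the colourings without a solution among the
-- first few elements form a computable binary tree, whose levels are finite and can be searched.

open import Defs
open import Algebra.Bundles using (AbelianGroup)
open import Algebra.Core using (Op₁; Op₂)
import Algebra.Definitions.RawMonoid as RawMonoidDefinitions
import Algebra.Properties.AbelianGroup as AbelianGroupProperties
import Algebra.Properties.CommutativeSemigroup as CommutativeSemigroupProperties
import Algebra.Properties.Monoid.Mult as MonoidMult
import Algebra.Properties.Monoid.Sum as MonoidSum
open import Algebra.Structures using (IsAbelianGroup)
open import Data.Bool.Base using (Bool; true; false; T)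
open import Data.Bool.Properties using (T?; T-irrelevant)
open import Data.Empty using (⊥-elim)
open import Data.Fin.Base using (Fin; zero; suc; toℕ; fromℕ<)
open import Data.Fin.Patterns using (0F; 1F; 2F; 3F)
open import Data.Fin.Properties using (toℕ-fromℕ<)
open import Data.Integer.Base as ℤ using (ℤ; +_; -[1+_])
import Data.Integer.DivMod as ℤ
open import Data.Integer.Divisibility.Signed as ℤ using (divides)
import Data.Integer.Properties as ℤ
open import Data.Integer.Tactic.RingSolver using (solve-∀)
open import Data.List.Base using (List; []; _∷_; _++_; applyUpTo; drop; length)
open import Data.List.Membership.Propositional using (_∈_)
open import Data.List.Properties using (length-applyUpTo; length-++)
open import Data.List.Relation.Unary.Any using (here; there)
open import Data.Nat.Base
open import Data.Nat.DivMod
open import Data.Nat.Divisibility using (_∣_; divides; ∣⇒≤; ∣-trans; _∣0; n∣m*n; m%n≡0⇒n∣m)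
open import Data.Nat.Induction using (<-rec)
open import Data.Nat.Primality using (Prime)
open import Data.Nat.Properties
open import Data.Product.Base using (∃; _×_; _,_; proj₁; proj₂; uncurry)
open import Data.Sum.Base using (_⊎_; inj₁; inj₂; [_,_]′)
open import Data.Unit.Base using (⊤; tt)
open import Data.Vec.Base using (Vec; []; _∷_; lookup; tabulate)
open import Data.Vec.Functional using (Vector) renaming (_∷_ to _∷ᵛ_)
open import Data.Vec.Relation.Binary.Pointwise.Inductive using (Pointwise; []; _∷_)
open import Function.Base using (_∘_; id)
open import Level using (0ℓ)
open import Relation.Binary.PropositionalEquality
open import Relation.Nullary using (¬_; Dec; yes; no)

open CommutativeSemigroupProperties *-commutativeSemigroup using (x∙yz≈y∙xz)

-- Closure properties of relative computability

isZero : ℕ → ℕ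
isZero zero    = 1
isZero (suc _) = 0

lsb : ℕ → ℕ
lsb zero    = 0
lsb (suc n) = isZero (lsb n)

∑< : ℕ → (ℕ → ℕ) → ℕ
∑< zero    f = 0
∑< (suc s) f = ∑< s f + f s

equals : ℕ → ℕ → ℕ
equals x y = isZero ((x ∸ y) + (y ∸ x))

module _ {X : ℕ → ℕ} where

  private variable
    A B : Set
    m n : ℕ
    enc : A → Vec ℕ n
    f g : A → ℕ

  Computable₁ : (ℕ → ℕ) → Set
  Computable₁ = ComputableIn X (_∷ [])

  Computable₂ : (ℕ → ℕ → ℕ) → Set
  Computable₂ h = ComputableIn X (λ (x , y) → x ∷ y ∷ []) (uncurry h)

  computable-resp : f ≗ g → ComputableIn X enc f → ComputableIn X enc g
  computable-resp {enc = enc} f≗g (e , ⇓e) = e , λ a → subst (X ⊢ e ⟨ enc a ⟩⇓_) (f≗g a) (⇓e a)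

  pointwise-tabulate : {ys : Vec ℕ m} {xs : Vec ℕ n} {es : Fin m → Code n} →
    (∀ i → X ⊢ es i ⟨ xs ⟩⇓ lookup ys i) → Pointwise (λ e y → X ⊢ e ⟨ xs ⟩⇓ y) (tabulate es) ys
  pointwise-tabulate {ys = []}    ⇓es = []
  pointwise-tabulate {ys = _ ∷ _} ⇓es = ⇓es zero ∷ pointwise-tabulate (⇓es ∘ suc)

  -- Codes of the group operations need only converge on elements of the group. Presenting the
  -- arguments as a map `φ` into `B` keeps every composite where the outer code converges.
  compose : {enc′ : B → Vec ℕ m} {f : B → ℕ} → ComputableIn X enc′ f → (φ : A → B) →
    (∀ i → ComputableIn X enc (λ a → lookup (enc′ (φ a)) i)) → ComputableIn X enc (f ∘ φ)
  compose (e , ⇓e) φ cs =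
    comp e (tabulate (proj₁ ∘ cs)) ,
    λ a → ⇓comp (pointwise-tabulate (λ i → proj₂ (cs i) a)) (⇓e (φ a))

  compose₁ : ∀ {h} → Computable₁ h → ComputableIn X enc f → ComputableIn X enc (h ∘ f)
  compose₁ {f = f} ch cf = compose ch f λ { 0F → cf }

  compose₂ : ∀ {h} → Computable₂ h → ComputableIn X enc f → ComputableIn X enc g →
    ComputableIn X enc (λ a → h (f a) (g a))
  compose₂ {f = f} {g = g} ch cf cg = compose ch (λ a → f a , g a) λ { 0F → cf ; 1F → cg }

  variable-computable : ∀ i → ComputableIn X enc (λ a → lookup (enc a) i)
  variable-computable i = proj i , λ a → ⇓proj i

  suc-computable : Computable₁ suc
  suc-computable = suc , λ _ → ⇓suc

  constant-computable : ∀ c → ComputableIn X enc (λ _ → c)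
  constant-computable zero    = zero , λ _ → ⇓zero
  constant-computable (suc c) = compose₁ suc-computable (constant-computable c)

  -- The function `f` is given in advance and only has to satisfy the recursion equations, so
  -- functions defined by pattern matching can be used as they stand.
  primitive-recursion : {enc : A → Vec ℕ n} {base : A → ℕ} {step : ℕ × ℕ × A → ℕ} {f : ℕ → A → ℕ} →
    ComputableIn X enc base → ComputableIn X (λ (k , y , a) → k ∷ y ∷ enc a) step →
    (∀ a → base a ≡ f 0 a) → (∀ k a → step (k , f k a , a) ≡ f (suc k) a) →
    ComputableIn X (λ (k , a) → k ∷ enc a) (uncurry f)
  primitive-recursion {A} {enc = enc} {f = f} (e , ⇓e) (e′ , ⇓e′) base≡ step≡ =
    rec e e′ , uncurry ⇓rec
    where
    ⇓rec : ∀ k a → X ⊢ rec e e′ ⟨ k ∷ enc a ⟩⇓ f k a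
    ⇓rec zero    a = ⇓rec₀ (subst (X ⊢ e ⟨ enc a ⟩⇓_) (base≡ a) (⇓e a))
    ⇓rec (suc k) a = ⇓rec₁ (⇓rec k a) (subst (X ⊢ e′ ⟨ k ∷ f k a ∷ enc a ⟩⇓_) (step≡ k a) (⇓e′ (k , f k a , a)))

  unary-recursion : {step : ℕ → ℕ → ℕ} (f : ℕ → ℕ) → Computable₂ step →
    (∀ k → step k (f k) ≡ f (suc k)) → Computable₁ f
  unary-recursion f c step≡ =
    compose
      (primitive-recursion {A = ⊤} {enc = λ _ → []} {f = λ k _ → f k} (constant-computable (f 0))
        (compose c (λ (k , y , _) → k , y) λ { 0F → variable-computable 0F ; 1F → variable-computable 1F })
        (λ _ → refl) (λ k _ → step≡ k))
      (_, tt) λ { 0F → variable-computable 0F }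

  +-computable : Computable₂ _+_
  +-computable = primitive-recursion {enc = _∷ []} (variable-computable 0F)
    (compose₁ suc-computable (variable-computable 1F)) (λ _ → refl) (λ _ _ → refl)

  *-computable : Computable₂ _*_
  *-computable = primitive-recursion {enc = _∷ []} (constant-computable 0)
    (compose₂ +-computable (variable-computable 2F) (variable-computable 1F)) (λ _ → refl) (λ _ _ → refl)

  pred-computable : Computable₁ pred
  pred-computable = unary-recursion pred (variable-computable 0F) (λ _ → refl)

  isZero-computable : Computable₁ isZero
  isZero-computable = unary-recursion isZero (constant-computable 0) (λ _ → refl)

  lsb-computable : Computable₁ lsb
  lsb-computable = unary-recursion lsb (compose₁ isZero-computable (variable-computable 1F)) (λ _ → refl)

  ∸-computable : Computable₂ _∸_
  ∸-computable = compose
    -- `rec` recurses on its first argument but truncated subtraction on its second, hence the swap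
    -- here and its reversal below.
    (primitive-recursion {enc = _∷ []} {f = λ y x → x ∸ y} (variable-computable 0F)
      (compose₁ pred-computable (variable-computable 1F)) (λ _ → refl) (λ k a → pred[m∸n]≡m∸[1+n] a k))
    (λ (x , y) → y , x) λ { 0F → variable-computable 1F ; 1F → variable-computable 0F }

  equals-computable : Computable₂ equals
  equals-computable = compose₁ isZero-computable
    (compose₂ +-computable ∸-computable
      (compose₂ ∸-computable (variable-computable 1F) (variable-computable 0F)))

  ∑<-computable : {enc : A → Vec ℕ n} {F : ℕ → A → ℕ} {s : A → ℕ} →
    ComputableIn X (λ (i , a) → i ∷ enc a) (uncurry F) → ComputableIn X enc s →
    ComputableIn X enc (λ a → ∑< (s a) (λ i → F i a))
  ∑<-computable {enc = enc} {F = F} {s} cF cs =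
    compose
      (primitive-recursion {enc = enc} {f = λ t a → ∑< t (λ i → F i a)} (constant-computable 0)
        (compose₂ +-computable (variable-computable 1F)
          (compose cF (λ (i , _ , a) → i , a)
            -- The summand depends on the index and the parameters but not on the partial sum, so
            -- variable 1 is skipped.
            λ { zero → variable-computable 0F ; (suc i) → variable-computable (suc (suc i)) }))
        (λ _ → refl) (λ _ _ → refl))
      (λ a → s a , a) λ { zero → cs ; (suc i) → variable-computable i }

-- Codes of binary strings

-- ⌊n/2⌋ is the number of odd numbers below n.
tailCode : ℕ → ℕ
tailCode c = ∑< (pred c) lsb

dropCode : ℕ → ℕ → ℕ
dropCode zero    c = c
dropCode (suc i) c = tailCode (dropCode i c)

-- Beyond the end of the string the bit is 0.
bitAt : ℕ → ℕ → ℕ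
bitAt c i = lsb (pred (dropCode i c))

-- Only the empty string has code 0, so position `i` exists exactly if something is left after
-- dropping `i` bits.
inRange : ℕ → ℕ → ℕ
inRange c i = isZero (isZero (dropCode i c))

module _ {X : ℕ → ℕ} where

  dropCode-computable : Computable₂ {X} dropCode
  dropCode-computable = primitive-recursion {enc = _∷ []} (variable-computable 0F)
    (∑<-computable (compose₁ lsb-computable (variable-computable 0F))
      (compose₁ pred-computable (variable-computable 1F)))
    (λ _ → refl) (λ _ _ → refl)

  bitAt-computable : Computable₂ {X} bitAt
  bitAt-computable = compose₁ lsb-computable (compose₁ pred-computable
    (compose₂ dropCode-computable (variable-computable 1F) (variable-computable 0F)))

  inRange-computable : Computable₂ {X} inRange
  inRange-computable = compose₁ isZero-computable (compose₁ isZero-computable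
    (compose₂ dropCode-computable (variable-computable 1F) (variable-computable 0F)))

lsb-2* : ∀ m → lsb (2 * m) ≡ 0
lsb-2* zero    = refl
lsb-2* (suc m) rewrite +-suc m (m + 0) | lsb-2* m = refl

∑<-lsb : ∀ m → ∑< (2 * m) lsb ≡ m
∑<-lsb zero    = refl
∑<-lsb (suc m) rewrite +-suc m (m + 0) | lsb-2* m | ∑<-lsb m | +-identityʳ m = +-comm m 1

tailCode-⌜∷⌝ : ∀ b σ → tailCode ⌜ b ∷ σ ⌝ ≡ ⌜ σ ⌝
tailCode-⌜∷⌝ false σ = ∑<-lsb ⌜ σ ⌝
tailCode-⌜∷⌝ true  σ rewrite lsb-2* ⌜ σ ⌝ = trans (+-identityʳ _) (∑<-lsb ⌜ σ ⌝)

lsb-⌜∷⌝ : ∀ b σ → lsb (pred ⌜ b ∷ σ ⌝) ≡ bit b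
lsb-⌜∷⌝ false σ = lsb-2* ⌜ σ ⌝
lsb-⌜∷⌝ true  σ rewrite lsb-2* ⌜ σ ⌝ = refl

-- Primitive recursion applies the last `tailCode` outermost; induction on strings needs the first
-- one innermost.
dropCode-suc : ∀ i c → dropCode (suc i) c ≡ dropCode i (tailCode c)
dropCode-suc zero    c = refl
dropCode-suc (suc i) c = cong tailCode (dropCode-suc i c)

dropCode-⌜⌝ : ∀ i σ → dropCode i ⌜ σ ⌝ ≡ ⌜ drop i σ ⌝
dropCode-⌜⌝ zero    σ       = refl
dropCode-⌜⌝ (suc i) []      = trans (dropCode-suc i 0) (trans (dropCode-⌜⌝ i []) (cong ⌜_⌝ (drop-[] i)))
  where
  drop-[] : ∀ i → drop i [] ≡ []
  drop-[] zero    = refl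
  drop-[] (suc i) = refl
dropCode-⌜⌝ (suc i) (b ∷ σ) = trans (dropCode-suc i ⌜ b ∷ σ ⌝)
  (trans (cong (dropCode i) (tailCode-⌜∷⌝ b σ)) (dropCode-⌜⌝ i σ))

bitAt-++ : ∀ σ τ {i} → i < length σ → bitAt ⌜ σ ++ τ ⌝ i ≡ bitAt ⌜ σ ⌝ i
bitAt-++ (b ∷ σ) τ {zero} _ = trans (lsb-⌜∷⌝ b (σ ++ τ)) (sym (lsb-⌜∷⌝ b σ))
bitAt-++ (b ∷ σ) τ {suc i} (s≤s i<)
  rewrite dropCode-suc i ⌜ b ∷ σ ⌝ | dropCode-suc i ⌜ b ∷ σ ++ τ ⌝
        | tailCode-⌜∷⌝ b σ | tailCode-⌜∷⌝ b (σ ++ τ) = bitAt-++ σ τ i<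

bitAt-applyUpTo : ∀ f m {i} → i < m → bitAt ⌜ applyUpTo f m ⌝ i ≡ bit (f i)
bitAt-applyUpTo f (suc m) {zero}  _ = lsb-⌜∷⌝ (f 0) (applyUpTo (f ∘ suc) m)
bitAt-applyUpTo f (suc m) {suc i} (s≤s i<)
  rewrite dropCode-suc i ⌜ applyUpTo f (suc m) ⌝
        | tailCode-⌜∷⌝ (f 0) (applyUpTo (f ∘ suc) m) = bitAt-applyUpTo (f ∘ suc) m i<

inRange⇒< : ∀ σ i → inRange ⌜ σ ⌝ i ≢ 0 → i < length σ
inRange⇒< σ i rewrite dropCode-⌜⌝ i σ = go i σ
  where
  go : ∀ i σ → isZero (isZero ⌜ drop i σ ⌝) ≢ 0 → i < length σ
  go zero    []      ≢0 = ⊥-elim (≢0 refl)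
  go zero    (_ ∷ σ) _  = z<s
  go (suc i) []      ≢0 = ⊥-elim (≢0 refl)
  go (suc i) (_ ∷ σ) ≢0 = s<s (go i σ ≢0)

<⇒inRange : ∀ σ i → i < length σ → inRange ⌜ σ ⌝ i ≡ 1
<⇒inRange σ i i< rewrite dropCode-⌜⌝ i σ = go i σ i<
  where
  go : ∀ i σ → i < length σ → isZero (isZero ⌜ drop i σ ⌝) ≡ 1
  go zero    (_ ∷ σ) _        = refl
  go (suc i) (_ ∷ σ) (s≤s i<) = go i σ i<

length≤⌜⌝ : ∀ σ → length σ ≤ ⌜ σ ⌝
length≤⌜⌝ []      = z≤n
length≤⌜⌝ (b ∷ σ) = s≤s (≤-trans (length≤⌜⌝ σ)
  (≤-trans (m≤m+n ⌜ σ ⌝ (⌜ σ ⌝ + 0)) (m≤n+m (2 * ⌜ σ ⌝) (bit b))))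

-- The tree of partial colourings without a solution

isZero-+ : ∀ m n → isZero (m + n) ≢ 0 → m ≡ 0 × n ≡ 0
isZero-+ zero    zero    _  = refl , refl
isZero-+ zero    (suc n) ≢0 = ⊥-elim (≢0 refl)
isZero-+ (suc m) n       ≢0 = ⊥-elim (≢0 refl)

equals⇒≡ : ∀ x y → equals x y ≢ 0 → x ≡ y
equals⇒≡ x y ≢0 with isZero-+ (x ∸ y) (y ∸ x) ≢0
... | x∸y≡0 , y∸x≡0 = ≤-antisym (m∸n≡0⇒m≤n x∸y≡0) (m∸n≡0⇒m≤n y∸x≡0)

equals-refl : ∀ x → equals x x ≡ 1
equals-refl x rewrite n∸n≡0 x = refl

∑<-≡0⇒ : ∀ s f {i} → ∑< s f ≡ 0 → i < s → f i ≡ 0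
∑<-≡0⇒ (suc s) f {i} eq i<1+s with m≤n⇒m<n∨m≡n (≤-pred i<1+s)
... | inj₁ i<s  = ∑<-≡0⇒ s f (m+n≡0⇒m≡0 _ eq) i<s
... | inj₂ refl = m+n≡0⇒n≡0 (∑< s f) eq

∑<-≡0⇐ : ∀ s f → (∀ i → f i ≡ 0) → ∑< s f ≡ 0
∑<-≡0⇐ zero    f eq = refl
∑<-≡0⇐ (suc s) f eq = cong₂ _+_ (∑<-≡0⇐ s f eq) (eq s)

∑<-cong : ∀ s {f g} → (∀ i → i < s → f i ≡ g i) → ∑< s f ≡ ∑< s g
∑<-cong zero    eq = refl
∑<-cong (suc s) eq = cong₂ _+_ (∑<-cong s (λ i i<s → eq i (m<n⇒m<1+n i<s))) (eq s ≤-refl)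

∑<-bits : ∀ s f → ∑< s (bit ∘ f) ≤ s
∑<-bits zero    f = z≤n
∑<-bits (suc s) f = ≤-trans (+-mono-≤ (∑<-bits s f) (bit≤1 (f s))) (≤-reflexive (+-comm s 1))
  where
  bit≤1 : ∀ b → bit b ≤ 1
  bit≤1 false = z≤n
  bit≤1 true  = ≤-refl

-- The colour of element x is the number of ones in its block of K bits, so that every infinite
-- sequence of bits decodes to a colouring with the K + 1 colours 0, …, K.
block : ℕ → (ℕ → ℕ) → ℕ → ℕ
block K β x = ∑< K (λ j → β (j + x * K))

block-cong : ∀ K {β γ x} → (∀ i → i < K + x * K → β i ≡ γ i) → block K β x ≡ block K γ x
block-cong K {x = x} eq = ∑<-cong K λ j j<K → eq (j + x * K) (+-monoˡ-< (x * K) j<K)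

module _ {X : ℕ → ℕ} {A : Set} {n : ℕ} {enc : A → Vec ℕ n} where
  block-computable : ∀ K {β : ℕ → A → ℕ} {x} → ComputableIn X (λ (i , a) → i ∷ enc a) (uncurry β) →
    ComputableIn X enc x → ComputableIn X enc (λ a → block K (λ i → β i a) (x a))
  block-computable K {x = x} cβ (ex , ⇓x) =
    ∑<-computable
      (compose cβ (λ (j , a) → j + x a * K , a) λ
        { zero    → compose₂ +-computable (variable-computable zero)
            (compose₂ *-computable
              (compose (ex , ⇓x) proj₂ (λ i → variable-computable (suc i))) (constant-computable K))
        ; (suc i) → variable-computable (suc i) })
      (constant-computable K)

-- Position K + x * K is the first one after block x, so elements whose block is incomplete are ignored.
same : ℕ → ℕ → ℕ → ℕ → ℕ
same K c x y = (inRange c (K + x * K) * inRange c (K + y * K)) * equals (block K (bitAt c) x) (block K (bitAt c) y)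

same≢0⇒ : ∀ K σ x y → same K ⌜ σ ⌝ x y ≢ 0 →
  K + x * K < length σ × K + y * K < length σ × block K (bitAt ⌜ σ ⌝) x ≡ block K (bitAt ⌜ σ ⌝) y
same≢0⇒ K σ x y ≢0 =
  inRange⇒< σ _ (≢0 ∘ cong (λ z → z * r * e)) ,
  inRange⇒< σ _ (λ eq → ≢0 (cong (_* e) (trans (cong (q *_) eq) (*-zeroʳ q)))) ,
  equals⇒≡ _ _ (λ eq → ≢0 (trans (cong (q * r *_) eq) (*-zeroʳ (q * r))))
  where
  q = inRange ⌜ σ ⌝ (K + x * K)
  r = inRange ⌜ σ ⌝ (K + y * K)
  e = equals (block K (bitAt ⌜ σ ⌝) x) (block K (bitAt ⌜ σ ⌝) y)

same≢0⇐ : ∀ K σ x y → K + x * K < length σ → K + y * K < length σ →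
  block K (bitAt ⌜ σ ⌝) x ≡ block K (bitAt ⌜ σ ⌝) y → same K ⌜ σ ⌝ x y ≢ 0
same≢0⇐ K σ x y x< y< eq
  rewrite <⇒inRange σ _ x< | <⇒inRange σ _ y< | eq | equals-refl (block K (bitAt ⌜ σ ⌝) y) = λ ()

-- Only complete blocks are compared, and appending bits leaves a complete block unchanged.
same-++ : ∀ K σ τ x y → same K ⌜ σ ⌝ x y ≢ 0 → same K ⌜ σ ++ τ ⌝ x y ≢ 0
same-++ K σ τ x y ≢0 with same≢0⇒ K σ x y ≢0
... | x< , y< , eq = same≢0⇐ K (σ ++ τ) x y (longer x<) (longer y<)
  (trans (extend x x<) (trans eq (sym (extend y y<))))
  where
  longer : ∀ {i} → i < length σ → i < length (σ ++ τ)
  longer i< = ≤-trans i< (≤-trans (m≤m+n _ _) (≤-reflexive (sym (length-++ σ))))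
  extend : ∀ x → K + x * K < length σ → block K (bitAt ⌜ σ ++ τ ⌝) x ≡ block K (bitAt ⌜ σ ⌝) x
  extend x x< = block-cong K {x = x} λ i i< → bitAt-++ σ τ (<-trans i< x<)

string? : (p : List Bool → Bool) → ∀ L → Dec (∃ λ σ → length σ ≡ L × T (p σ))
string? p zero with T? (p [])
... | yes t = yes ([] , refl , t)
... | no ¬t = no λ { ([] , _ , t) → ¬t t }
string? p (suc L) with string? (p ∘ (false ∷_)) L | string? (p ∘ (true ∷_)) L
... | yes (σ , eq , t) | _ = yes (false ∷ σ , cong suc eq , t)
... | no _ | yes (σ , eq , t) = yes (true ∷ σ , cong suc eq , t)
... | no ¬f | no ¬t = no λ
  { (false ∷ σ , eq , t) → ¬f (σ , suc-injective eq , t)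
  ; (true  ∷ σ , eq , t) → ¬t (σ , suc-injective eq , t) }

bit-T : ∀ {b} → T b → bit b ≡ 1
bit-T {true} _ = refl

bit-¬T : ∀ {b} → ¬ T b → bit b ≡ 0
bit-¬T {false} _  = refl
bit-¬T {true}  ¬t = ⊥-elim (¬t _)

-- Computability of the avoidance tree of a computable group

module _ (G : ComputableAbelianGroup) where
  open ComputableAbelianGroup G
  open AbelianGroup abelianGroup using (assoc; identityʳ)

  private
    Computable₀ = ComputableIn (λ _ → 0)

  carrier-≡ : {x y : Carrier} → proj₁ x ≡ proj₁ y → x ≡ y
  carrier-≡ {_ , d} {_ , d′} refl = cong (_ ,_) (T-irrelevant d d′)

  -- Makes the group operations total: their codes need not converge outside the domain.
  point : ℕ → Carrier
  point m with T? (domain m)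
  ... | yes d = m , d
  ... | no  _ = 0#

  point-proj₁ : ∀ x → point (proj₁ x) ≡ x
  point-proj₁ (m , d) with T? (domain m)
  ... | yes d′ = carrier-≡ refl
  ... | no  ¬d = ⊥-elim (¬d d)

  -- The case distinction becomes arithmetic: both outcomes are weighted by the characteristic
  -- functions of the domain and of its complement, then added.
  point-computable : Computable₀ (_∷ []) (proj₁ ∘ point)
  point-computable = computable-resp correct
    (compose₂ +-computable
      (compose₂ *-computable domain-computable (variable-computable 0F))
      (compose₂ *-computable (compose₁ isZero-computable domain-computable) (constant-computable (proj₁ 0#))))
    where
    correct : ∀ m → bit (domain m) * m + isZero (bit (domain m)) * proj₁ 0# ≡ proj₁ (point m)
    correct m with T? (domain m)
    ... | yes d rewrite bit-T d  = trans (+-identityʳ _) (*-identityˡ m)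
    ... | no ¬d rewrite bit-¬T ¬d = *-identityˡ _

  module _ (b : Carrier) (K : ℕ) where

    -- Counting solutions, instead of searching for one, needs only bounded sums and products.
    solutions : ℕ → ℕ → Carrier → ℕ
    solutions zero    c h = equals (proj₁ h) (proj₁ b)
    solutions (suc i) c h = ∑< c λ x → ∑< c λ y → same K c x y * solutions i c (h ⊕ (point x - point y))

    difference : ∀ {i} → Vector ℕ i → Vector ℕ i → Carrier
    difference x y = sum (λ j → point (x j) - point (y j))

    -- The sum `h` of the differences chosen so far is arbitrary, so that the induction can absorb
    -- the first pair into it.
    solutions≡0⇒ : .{{NonZero K}} → ∀ σ i h → solutions i ⌜ σ ⌝ h ≡ 0 → (x y : Vector ℕ i) →
      (∀ j → same K ⌜ σ ⌝ (x j) (y j) ≢ 0) → h ⊕ difference x y ≢ b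
    solutions≡0⇒ σ zero h ≡0 x y same≢0 sol
      rewrite trans (sym (identityʳ h)) sol | equals-refl (proj₁ b) = 1+n≢0 ≡0
    solutions≡0⇒ σ (suc i) h ≡0 x y same≢0 sol =
      solutions≡0⇒ σ i (h ⊕ (point (x zero) - point (y zero)))
        -- The term of the double sum at the first pair is 0 while its factor `same` is not, so the
        -- count for the remaining pairs is 0.
        ([ ⊥-elim ∘ same≢0 zero , id ]′ (m*n≡0⇒m≡0∨n≡0 (same K ⌜ σ ⌝ (x zero) (y zero))
          (∑<-≡0⇒ ⌜ σ ⌝ _ (∑<-≡0⇒ ⌜ σ ⌝ _ ≡0 (bounded (x zero) x<)) (bounded (y zero) y<))))
        (x ∘ suc) (y ∘ suc) (same≢0 ∘ suc) (trans (assoc h _ _) sol)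
      where
      x< = proj₁ (same≢0⇒ K σ (x zero) (y zero) (same≢0 zero))
      y< = proj₁ (proj₂ (same≢0⇒ K σ (x zero) (y zero) (same≢0 zero)))
      -- The sums run up to the code of `σ`. They reach every element with a complete block, since a
      -- string is no longer than its code.
      bounded : ∀ x → K + x * K < length σ → x < ⌜ σ ⌝
      bounded x x< = ≤-<-trans (≤-trans (m≤m*n x K) (m≤n+m _ K)) (<-≤-trans x< (length≤⌜⌝ σ))

    solutions≡0⇐ : ∀ σ i h → ((x y : Vector ℕ i) →
      (∀ j → same K ⌜ σ ⌝ (x j) (y j) ≢ 0) → h ⊕ difference x y ≢ b) → solutions i ⌜ σ ⌝ h ≡ 0
    solutions≡0⇐ σ zero h avoids with equals (proj₁ h) (proj₁ b) ≟ 0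
    ... | yes ≡0 = ≡0
    ... | no  ≢0 = ⊥-elim (avoids (λ ()) (λ ()) (λ ())
      (trans (identityʳ h) (carrier-≡ (equals⇒≡ _ _ ≢0))))
    solutions≡0⇐ σ (suc i) h avoids = ∑<-≡0⇐ ⌜ σ ⌝ _ λ x → ∑<-≡0⇐ ⌜ σ ⌝ _ λ y → step x y
      where
      step : ∀ x y → same K ⌜ σ ⌝ x y * solutions i ⌜ σ ⌝ (h ⊕ (point x - point y)) ≡ 0
      step x y with same K ⌜ σ ⌝ x y ≟ 0
      ... | yes ≡0 rewrite ≡0 = refl
      ... | no  ≢0 = trans (cong (same K ⌜ σ ⌝ x y *_)
        (solutions≡0⇐ σ i _ λ xs ys same≢0 sol → avoids (x ∷ᵛ xs) (y ∷ᵛ ys)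
          (λ { zero → ≢0 ; (suc j) → same≢0 j }) (trans (sym (assoc h _ _)) sol)))
        (*-zeroʳ (same K ⌜ σ ⌝ x y))

    same-computable : Computable₀ {A = ℕ × ℕ × ℕ} (λ (c , x , y) → c ∷ x ∷ y ∷ []) (λ (c , x , y) → same K c x y)
    same-computable = compose₂ *-computable
      (compose₂ *-computable (inRange? (variable-computable 1F)) (inRange? (variable-computable 2F)))
      (compose₂ equals-computable (color (variable-computable 1F)) (color (variable-computable 2F)))
      where
      inRange? : {f : ℕ × ℕ × ℕ → ℕ} → Computable₀ (λ (c , x , y) → c ∷ x ∷ y ∷ []) f →
        Computable₀ (λ (c , x , y) → c ∷ x ∷ y ∷ []) (λ a → inRange (proj₁ a) (K + f a * K))
      inRange? cf = compose₂ inRange-computable (variable-computable 0F)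
        (compose₂ +-computable (constant-computable K) (compose₂ *-computable cf (constant-computable K)))
      color : {f : ℕ × ℕ × ℕ → ℕ} → Computable₀ (λ (c , x , y) → c ∷ x ∷ y ∷ []) f →
        Computable₀ (λ (c , x , y) → c ∷ x ∷ y ∷ []) (λ a → block K (bitAt (proj₁ a)) (f a))
      color cf = block-computable K (compose₂ bitAt-computable (variable-computable 1F) (variable-computable 0F)) cf

    solutions-computable : ∀ i → Computable₀ {A = ℕ × Carrier} (λ (c , h) → c ∷ proj₁ h ∷ []) (uncurry (solutions i))
    solutions-computable zero    = compose₂ equals-computable (variable-computable 1F) (constant-computable (proj₁ b))
    solutions-computable (suc i) =
      ∑<-computable {F = λ x (c , h) → ∑< c λ y → same K c x y * solutions i c (h ⊕ (point x - point y))}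
        (∑<-computable {F = λ y (x , c , h) → same K c x y * solutions i c (h ⊕ (point x - point y))}
          (compose₂ *-computable
            (compose same-computable (λ (y , x , c , _) → c , x , y) λ
              { 0F → variable-computable 2F ; 1F → variable-computable 1F ; 2F → variable-computable 0F })
            (compose (solutions-computable i) (λ (y , x , c , h) → c , h ⊕ (point x - point y)) λ
              { 0F → variable-computable 2F
              ; 1F → compose ⊕-computable (λ (y , x , c , h) → h , (point x - point y)) λ
                { 0F → variable-computable 3F
                ; 1F → compose ⊕-computable (λ (y , x , _) → point x , (⊖ point y)) λ
                  { 0F → compose point-computable (λ (_ , x , _) → x) λ { 0F → variable-computable 1F }
                  ; 1F → compose ⊖-computable (λ (y , _) → point y) λ
                    { 0F → compose point-computable (λ (y , _) → y) λ { 0F → variable-computable 0F } } } } }))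
          (variable-computable 1F))
        (variable-computable 0F)

    avoidanceTree : .{{NonZero K}} → ℕ → ComputableBinaryTree
    avoidanceTree n = record
      { member = member
      -- A solution already visible in `σ` would remain visible in `σ ++ τ`.
      ; closed = λ σ τ t → ≡⇒≡ᵇ _ 0 (solutions≡0⇐ σ n 0# λ x y same≢0 →
          solutions≡0⇒ (σ ++ τ) n 0# (≡ᵇ⇒≡ _ 0 t) x y (λ j → same-++ K σ τ (x j) (y j) (same≢0 j)))
      ; member-computable = computable-resp (λ σ → bit-≡ᵇ0 (solutions n ⌜ σ ⌝ 0#)) (compose₁ isZero-computable
          (compose (solutions-computable n) (λ σ → ⌜ σ ⌝ , 0#) λ
            { 0F → variable-computable 0F ; 1F → constant-computable (proj₁ 0#) }))
      }
      where
      member : List Bool → Bool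
      member σ = solutions n ⌜ σ ⌝ 0# ≡ᵇ 0
      bit-≡ᵇ0 : ∀ m → isZero m ≡ bit (m ≡ᵇ 0)
      bit-≡ᵇ0 zero    = refl
      bit-≡ᵇ0 (suc m) = refl

-- Extending characters

-- If there is no least witness, strong induction refutes `P` everywhere. Constructively this yields
-- only the double negation.
¬¬-least : (P : ℕ → Set) → ¬ ¬ ((∃ λ j → P j × ∀ {i} → i < j → ¬ P i) ⊎ (∀ j → ¬ P j))
¬¬-least P k = k (inj₂ (<-rec _ λ j ih pj → k (inj₁ (j , pj , ih))))

-- A value v/M ∈ ℚ/ℤ for the character at b which is far enough from 0 to be missed by
-- every sum of n differences of values lying in a common arc [c/k, (c + 1)/k).
record Far (n k M v : ℕ) : Set where
  field
    M>0   : M > 0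
    2v≤M  : 2 * v ≤ M
    nM≤kv : n * M ≤ k * v

open Far

-- The fraction v/M is the same point of ℚ/ℤ over the larger denominator that an extension of the
-- character may require.
far-scale : ∀ {n k M v} j → j > 0 → Far n k M v → Far n k (j * M) (j * v)
far-scale {n} {k} {M} {v} j j>0 far = record
  { M>0   = *-mono-≤ j>0 (far .M>0)
  ; 2v≤M  = subst (_≤ j * M) (x∙yz≈y∙xz j 2 v) (*-monoʳ-≤ j (far .2v≤M))
  ; nM≤kv = subst₂ _≤_ (x∙yz≈y∙xz j n M) (x∙yz≈y∙xz j k v) (*-monoʳ-≤ j (far .nM≤kv)) }

module Characters {A : Set} {_⊕_ : Op₂ A} {0# : A} {⊖_ : Op₁ A}
  (isAbelianGroup : IsAbelianGroup _≡_ _⊕_ 0# ⊖_) where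

  private
    𝒜 : AbelianGroup 0ℓ 0ℓ
    𝒜 = record { isAbelianGroup = isAbelianGroup }

  open AbelianGroup 𝒜 using (_-_; rawMonoid; monoid; commutativeSemigroup; comm; identityˡ; identityʳ; inverseʳ)
  open RawMonoidDefinitions rawMonoid using (sum) renaming (_×_ to _·_)
  open MonoidMult monoid using (×-homo-+; ×-assocˡ)
  open AbelianGroupProperties 𝒜 using (⁻¹-∙-comm; ⁻¹-involutive; ε⁻¹≈ε; inverseˡ-unique; inverseʳ-unique; xyx⁻¹≈y)
  open CommutativeSemigroupProperties commutativeSemigroup using (interchange)

  -- Integer multiples in an abelian group

  infixr 8 _•_
  _•_ : ℤ → A → A
  (+ n)    • g = n · g
  -[1+ n ] • g = ⊖ (suc n · g)

  •-⊖ : ∀ m n g → (m ℤ.⊖ n) • g ≡ (m · g) - (n · g)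
  •-⊖ zero    zero    g = sym (inverseʳ 0#)
  •-⊖ (suc m) zero    g = trans (sym (identityʳ _)) (cong ((suc m · g) ⊕_) (sym ε⁻¹≈ε))
  •-⊖ zero    (suc n) g = sym (identityˡ _)
  •-⊖ (suc m) (suc n) g = begin
    (suc m ℤ.⊖ suc n) • g                   ≡⟨ cong (_• g) (ℤ.[1+m]⊖[1+n]≡m⊖n m n) ⟩
    (m ℤ.⊖ n) • g                           ≡⟨ •-⊖ m n g ⟩
    (m · g) - (n · g)                       ≡⟨ identityˡ _ ⟨
    0# ⊕ ((m · g) - (n · g))                ≡⟨ cong (_⊕ ((m · g) - (n · g))) (inverseʳ g) ⟨
    (g - g) ⊕ ((m · g) - (n · g))           ≡⟨ interchange g (⊖ g) (m · g) (⊖ (n · g)) ⟩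
    (g ⊕ (m · g)) ⊕ ((⊖ g) - (n · g))       ≡⟨ cong ((g ⊕ (m · g)) ⊕_) (⁻¹-∙-comm g (n · g)) ⟩
    (g ⊕ (m · g)) - (g ⊕ (n · g))           ∎
    where open ≡-Reasoning

  •-homo-+ : ∀ s t g → (s ℤ.+ t) • g ≡ (s • g) ⊕ (t • g)
  •-homo-+ (+ m)    (+ n)    g = ×-homo-+ g m n
  •-homo-+ (+ m)    -[1+ n ] g = •-⊖ m (suc n) g
  •-homo-+ -[1+ m ] (+ n)    g = trans (•-⊖ n (suc m) g) (comm (n · g) _)
  •-homo-+ -[1+ m ] -[1+ n ] g = begin
    ⊖ (suc (suc (m + n)) · g)          ≡⟨ cong (λ k → ⊖ (suc k · g)) (+-suc m n) ⟨
    ⊖ ((suc m + suc n) · g)            ≡⟨ cong ⊖_ (×-homo-+ g (suc m) (suc n)) ⟩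
    ⊖ ((suc m · g) ⊕ (suc n · g))      ≡⟨ ⁻¹-∙-comm (suc m · g) (suc n · g) ⟨
    (⊖ (suc m · g)) - (suc n · g)      ∎
    where open ≡-Reasoning

  •-neg : ∀ t g → (ℤ.- t) • g ≡ ⊖ (t • g)
  •-neg t g = inverseˡ-unique _ _ (trans (sym (•-homo-+ (ℤ.- t) t g)) (cong (_• g) (ℤ.+-inverseˡ t)))

  -- The graph of a character of a subgroup with values in (1/M)ℤ/ℤ, as a subgroup of A × ℤ.
  record Character (M : ℕ) : Set₁ where
    field
      Graph         : A → ℤ → Set
      ⊕-closed      : ∀ {x y s t} → Graph x s → Graph y t → Graph (x ⊕ y) (s ℤ.+ t)
      ⊖-closed      : ∀ {x s} → Graph x s → Graph (⊖ x) (ℤ.- s)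
      modulus       : ∀ {s} → + M ℤ.∣ s → Graph 0# s
      single-valued : ∀ {s} → Graph 0# s → + M ℤ.∣ s

    0-closed : Graph 0# (+ 0)
    0-closed = modulus (divides (+ 0) refl)

    ·-closed : ∀ n {x s} → Graph x s → Graph (n · x) (+ n ℤ.* s)
    ·-closed zero    _ = 0-closed
    ·-closed (suc n) {s = s} r = subst (Graph _) (sym (ℤ.suc-* (+ n) s)) (⊕-closed r (·-closed n r))

    single-valued′ : ∀ {x s t} → Graph x s → Graph x t → + M ℤ.∣ s ℤ.- t
    single-valued′ {x} r r′ = single-valued (subst (λ y → Graph y _) (inverseʳ x) (⊕-closed r (⊖-closed r′)))

  trivial : ∀ M → Character M
  trivial M = record
    { Graph         = λ x s → x ≡ 0# × + M ℤ.∣ s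
    ; ⊕-closed      = λ (x≡0 , M∣s) (y≡0 , M∣t) → trans (cong₂ _⊕_ x≡0 y≡0) (identityʳ 0#) , ℤ.∣m∣n⇒∣m+n M∣s M∣t
    ; ⊖-closed      = λ (x≡0 , M∣s) → trans (cong ⊖_ x≡0) ε⁻¹≈ε , ℤ.∣m⇒∣-m M∣s
    ; modulus       = refl ,_
    ; single-valued = proj₂
    }

  open Character

  -- Extends `χ` to the subgroup generated by its domain and `g`, with `g` sent to a/(jM) and each
  -- old value s/M rewritten as js/(jM). The hypothesis `consistent` is well-definedness: every
  -- relation between `g` and the domain must be sent to 0.
  module Adjoin {M} (χ : Character M) (j : ℕ) (g : A) (a : ℤ)
    (consistent : ∀ {y s} t → χ .Graph y s → y ⊕ (t • g) ≡ 0# → + (j * M) ℤ.∣ + j ℤ.* s ℤ.+ t ℤ.* a) where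

    adjoin : Character (j * M)
    adjoin .Graph x z = ∃ λ y → ∃ λ s → ∃ λ t →
      χ .Graph y s × x ≡ y ⊕ (t • g) × z ≡ + j ℤ.* s ℤ.+ t ℤ.* a
    adjoin .⊕-closed (y , s , t , r , refl , refl) (y′ , s′ , t′ , r′ , refl , refl) =
      y ⊕ y′ , s ℤ.+ s′ , t ℤ.+ t′ , χ .⊕-closed r r′ ,
      trans (interchange y (t • g) y′ (t′ • g)) (cong ((y ⊕ y′) ⊕_) (sym (•-homo-+ t t′ g))) ,
      rearrange (+ j) s t s′ t′ a
      where
      rearrange : ∀ j s t s′ t′ a → (j ℤ.* s ℤ.+ t ℤ.* a) ℤ.+ (j ℤ.* s′ ℤ.+ t′ ℤ.* a) ≡
        j ℤ.* (s ℤ.+ s′) ℤ.+ (t ℤ.+ t′) ℤ.* a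
      rearrange = solve-∀
    adjoin .⊖-closed (y , s , t , r , refl , refl) =
      ⊖ y , ℤ.- s , ℤ.- t , χ .⊖-closed r ,
      trans (sym (⁻¹-∙-comm y (t • g))) (cong ((⊖ y) ⊕_) (sym (•-neg t g))) ,
      rearrange (+ j) s t a
      where
      rearrange : ∀ j s t a → ℤ.- (j ℤ.* s ℤ.+ t ℤ.* a) ≡ j ℤ.* (ℤ.- s) ℤ.+ (ℤ.- t) ℤ.* a
      rearrange = solve-∀
    adjoin .modulus (divides q refl) =
      0# , q ℤ.* + M , + 0 , χ .modulus (divides q refl) , sym (identityʳ 0#) ,
      trans (cong (q ℤ.*_) (ℤ.pos-* j M)) (rearrange q (+ j) (+ M) a)
      where
      rearrange : ∀ q j m a → q ℤ.* (j ℤ.* m) ≡ j ℤ.* (q ℤ.* m) ℤ.+ (+ 0) ℤ.* a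
      rearrange = solve-∀
    adjoin .single-valued (y , s , t , r , eq , refl) = consistent t r (sym eq)

    adjoin-extends : ∀ {x s} → χ .Graph x s → adjoin .Graph x (+ j ℤ.* s)
    adjoin-extends {x} {s} r = x , s , + 0 , r , sym (identityʳ x) , sym (ℤ.+-identityʳ _)

    adjoin-value : adjoin .Graph g a
    adjoin-value = 0# , + 0 , + 1 , 0-closed χ ,
      sym (trans (identityˡ _) (identityʳ g)) , rearrange (+ j) a
      where
      rearrange : ∀ j a → a ≡ j ℤ.* (+ 0) ℤ.+ (+ 1) ℤ.* a
      rearrange = solve-∀

  open Adjoin

  record Extension {M} (χ : Character M) (g : A) : Set₁ where
    field
      scale      : ℕ
      scale>0    : scale > 0
      extended   : Character (scale * M)
      extends    : ∀ {x s} → χ .Graph x s → extended .Graph x (+ scale ℤ.* s)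
      value      : ∃ λ a → extended .Graph g a

  module _ {M} (χ : Character M) (g : A) where

    Meets : ℕ → Set
    Meets j = j > 0 × ∃ λ s → χ .Graph (j · g) s

    -- Division with remainder: the domain of `χ` is a subgroup, so it contains the multiple of `g`
    -- by `w % j`, and a nonzero remainder would contradict `least`. The values then agree modulo
    -- `M` by single-valuedness.
    multiple-of-least : ∀ {j a} → j > 0 → χ .Graph (j · g) a → (∀ {i} → i < j → ¬ Meets i) →
      ∀ w {s} → χ .Graph (w · g) s → ∃ λ q → w ≡ q * j × + M ℤ.∣ s ℤ.- + q ℤ.* a
    multiple-of-least {j} {a} j>0 r least w {s} rw =
      q , w≡q*j , single-valued′ χ (subst (λ k → χ .Graph (k · g) s) w≡q*j rw) rq
      where
      open ≡-Reasoning
      instance _ = >-nonZero j>0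
      q = w / j
      rq : χ .Graph ((q * j) · g) (+ q ℤ.* a)
      rq = subst (λ y → χ .Graph y _) (×-assocˡ g q j) (·-closed χ q r)
      remainder : (w · g) - ((q * j) · g) ≡ (w % j) · g
      remainder = begin
        (w · g) - ((q * j) · g)                               ≡⟨ cong (λ k → (k · g) - ((q * j) · g)) (trans (m≡m%n+[m/n]*n w j) (+-comm (w % j) (q * j))) ⟩
        ((q * j + w % j) · g) - ((q * j) · g)                 ≡⟨ cong (_- ((q * j) · g)) (×-homo-+ g (q * j) (w % j)) ⟩
        (((q * j) · g) ⊕ ((w % j) · g)) - ((q * j) · g)       ≡⟨ xyx⁻¹≈y ((q * j) · g) ((w % j) · g) ⟩
        (w % j) · g                                           ∎
      w%j≡0 : w % j ≡ 0
      w%j≡0 with w % j in eq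
      ... | zero  = refl
      ... | suc i = ⊥-elim (least (subst (_< j) eq (m%n<n w j))
        (z<s , s ℤ.- + q ℤ.* a , subst (λ x → χ .Graph x (s ℤ.- + q ℤ.* a)) (trans remainder (cong (_· g) eq)) (χ .⊕-closed rw (χ .⊖-closed rq))))
      w≡q*j : w ≡ q * j
      w≡q*j = trans (m≡m%n+[m/n]*n w j) (cong (_+ q * j) w%j≡0)

    -- If j is the order of g modulo the domain of χ, then χ(g) must be a j-th part of χ(j · g), hence the
    -- modulus j * M.  If no multiple of g lies in the domain, then χ(g) = 0 will do.
    extend : ¬ ¬ Extension χ g
    extend k = ¬¬-least Meets λ
      { (inj₁ (j , (j>0 , a , r) , least)) → k (root j>0 r least)
      ; (inj₂ never)                       → k (free never) }
      where
      root : ∀ {j a} → j > 0 → χ .Graph (j · g) a → (∀ {i} → i < j → ¬ Meets i) → Extension χ g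
      root {j} {a} j>0 r least = record
        { scale = j ; scale>0 = j>0
        ; extended = adjoin χ j g a consistent
        ; extends = adjoin-extends χ j g a consistent
        ; value = a , adjoin-value χ j g a consistent }
        where
        consistent : ∀ {y s} t → χ .Graph y s → y ⊕ (t • g) ≡ 0# → + (j * M) ℤ.∣ + j ℤ.* s ℤ.+ t ℤ.* a
        -- Here `w · g` is the inverse of `y` and has value -s, so with w = qj the number M divides
        -- -s - qa; multiplying by -j gives the claim. For negative `t` the multiple of `g` is `y`
        -- itself, with value s.
        consistent {y} {s} (+ w) ry eq
          with multiple-of-least j>0 r least w (subst (λ x → χ .Graph x _) (sym (inverseʳ-unique y (w · g) eq)) (χ .⊖-closed ry))
        ... | q , refl , M∣ = subst₂ ℤ._∣_ (sym (ℤ.pos-* j M))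
          (trans (rearrange (+ j) (+ q) s a) (cong (λ t → + j ℤ.* s ℤ.+ t ℤ.* a) (sym (ℤ.pos-* q j))))
          (ℤ.*-monoʳ-∣ (+ j) (ℤ.∣m⇒∣-m M∣))
          where
          rearrange : ∀ j q s a → j ℤ.* (ℤ.- (ℤ.- s ℤ.- q ℤ.* a)) ≡ j ℤ.* s ℤ.+ (q ℤ.* j) ℤ.* a
          rearrange = solve-∀
        consistent {y} {s} -[1+ w ] ry eq
          with multiple-of-least j>0 r least (suc w) (subst (λ x → χ .Graph x s) (trans (inverseˡ-unique y _ eq) (⁻¹-involutive _)) ry)
        ... | q , w≡ , M∣ = subst₂ ℤ._∣_ (sym (ℤ.pos-* j M))
          (trans (rearrange (+ j) (+ q) s a) (cong (λ t → + j ℤ.* s ℤ.+ (ℤ.- t) ℤ.* a) (trans (sym (ℤ.pos-* q j)) (cong +_ (sym w≡)))))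
          (ℤ.*-monoʳ-∣ (+ j) M∣)
          where
          rearrange : ∀ j q s a → j ℤ.* (s ℤ.- q ℤ.* a) ≡ j ℤ.* s ℤ.+ (ℤ.- (q ℤ.* j)) ℤ.* a
          rearrange = solve-∀
      free : (∀ j → ¬ Meets j) → Extension χ g
      free never = record
        { scale = 1 ; scale>0 = ≤-refl
        ; extended = adjoin χ 1 g (+ 0) consistent
        ; extends = adjoin-extends χ 1 g (+ 0) consistent
        ; value = + 0 , adjoin-value χ 1 g (+ 0) consistent }
        where
        -- A relation with `t` nonzero would put a positive multiple of `g` into the domain, so only
        -- t = 0 needs an actual check.
        consistent : ∀ {y s} t → χ .Graph y s → y ⊕ (t • g) ≡ 0# → + (1 * M) ℤ.∣ + 1 ℤ.* s ℤ.+ t ℤ.* (+ 0)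
        consistent {y} {s} (+ zero) ry eq = subst₂ (λ m s → + m ℤ.∣ s) (sym (*-identityˡ M))
          (trans (sym (ℤ.*-identityˡ s)) (sym (ℤ.+-identityʳ _)))
          (χ .single-valued (subst (λ x → χ .Graph x s) (trans (sym (identityʳ y)) eq) ry))
        consistent {y} (+ suc w) ry eq = ⊥-elim (never (suc w)
          (z<s , _ , subst (λ x → χ .Graph x _) (sym (inverseʳ-unique y (suc w · g) eq)) (χ .⊖-closed ry)))
        consistent {y} -[1+ w ] ry eq = ⊥-elim (never (suc w)
          (z<s , _ , subst (λ x → χ .Graph x _) (trans (inverseˡ-unique y _ eq) (⁻¹-involutive _)) ry))

  -- Characters on the first L elements and the colourings by arcs

  module _ (n k : ℕ) (point : ℕ → A) (b : A) where

    -- Each extension exists only up to double negation, which finitely many steps can accumulate;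
    -- hence values are required just below `L`.
    record Stage (L : ℕ) : Set₁ where
      field
        M v   : ℕ
        far   : Far n k M v
        χ     : Character M
        χb    : χ .Graph b (+ v)
        value : ∀ {x} → x < L → ∃ λ s → χ .Graph (point x) s

    -- Sending `b` to v/M respects every relation t • b = 0, because `M` divides each such t.
    stage-zero : ∀ {M v} → Far n k M v → (∀ w → w · b ≡ 0# → M ∣ w) → Stage 0
    stage-zero {M} {v} far annihilates = record
      { M = 1 * M ; v = v ; far = subst (λ m → Far n k m v) (sym (*-identityˡ M)) far
      ; χ = adjoin (trivial M) 1 b (+ v) consistent
      ; χb = adjoin-value (trivial M) 1 b (+ v) consistent
      ; value = λ () }
      where
      annihilates′ : ∀ t → t • b ≡ 0# → M ∣ ℤ.∣ t ∣
      annihilates′ (+ w)    eq = annihilates w eq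
      annihilates′ -[1+ w ] eq = annihilates (suc w) (trans (sym (⁻¹-involutive _)) (trans (cong ⊖_ eq) ε⁻¹≈ε))
      consistent : ∀ {y s} t → trivial M .Graph y s → y ⊕ (t • b) ≡ 0# → + (1 * M) ℤ.∣ + 1 ℤ.* s ℤ.+ t ℤ.* + v
      consistent {s = s} t (refl , M∣s) eq = subst (λ m → + m ℤ.∣ + 1 ℤ.* s ℤ.+ t ℤ.* + v) (sym (*-identityˡ M))
        (ℤ.∣m∣n⇒∣m+n (ℤ.∣n⇒∣m*n (+ 1) M∣s)
          (ℤ.∣m⇒∣m*n {m = t} (+ v) (ℤ.∣ᵤ⇒∣ (annihilates′ t (trans (sym (identityˡ _)) eq)))))

    stage-suc : ∀ {L} → Stage L → ¬ ¬ Stage (suc L)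
    stage-suc {L} stage ¬next = extend χ (point L) (¬next ∘ next)
      where
      open Stage stage
      next : Extension χ (point L) → Stage (suc L)
      next ext = record
        { M = scale * M ; v = scale * v ; far = far-scale scale scale>0 far
        ; χ = extended
        ; χb = subst (extended .Graph b) (sym (ℤ.pos-* scale v)) (extends χb)
        ; value = λ x<1+L → [ (λ x<L → _ , extends (proj₂ (Stage.value stage x<L))) , (λ { refl → Extension.value ext }) ]′
                              (m≤n⇒m<n∨m≡n (≤-pred x<1+L)) }
        where open Extension ext using (scale; scale>0; extended; extends)

    stages : Stage 0 → ∀ L → ¬ ¬ Stage L
    stages stage₀ zero    ¬stage = ¬stage stage₀
    stages stage₀ (suc L) ¬stage = stages stage₀ L λ stage → stage-suc stage ¬stage

    module ArcColoring {L} (stage : Stage L) where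
      open Stage stage

      private instance
        M≢0 : NonZero M
        M≢0 = >-nonZero (far .M>0)

      residue : ∀ {x} → x < L → ℕ
      residue x<L = proj₁ (value x<L) ℤ.%ℕ M

      residue-graph : ∀ {x} (x<L : x < L) → χ .Graph (point x) (+ residue x<L)
      residue-graph {x} x<L with value x<L
      -- The residue differs from `s` by a multiple of `M`, which the graph contains over `0#`.
      ... | s , r = subst₂ (χ .Graph) (identityʳ (point x)) eq
        (χ .⊕-closed r (χ .modulus (divides (ℤ.- (s ℤ./ℕ M)) refl)))
        where
        rearrange : ∀ r q m → (r ℤ.+ q ℤ.* m) ℤ.+ (ℤ.- q) ℤ.* m ≡ r
        rearrange = solve-∀
        eq : s ℤ.+ (ℤ.- (s ℤ./ℕ M)) ℤ.* + M ≡ + (s ℤ.%ℕ M)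
        eq = trans (cong (ℤ._+ (ℤ.- (s ℤ./ℕ M)) ℤ.* + M) (ℤ.a≡a%ℕn+[a/ℕn]*n s M)) (rearrange (+ (s ℤ.%ℕ M)) (s ℤ./ℕ M) (+ M))

      -- The index c of the arc [c/k, (c + 1)/k) containing the character value `residue x<L` / M.
      arc : ∀ {x} → x < L → ℕ
      arc x<L = residue x<L * k / M

      color : ℕ → ℕ
      color x with x <? L
      ... | yes x<L = arc x<L
      -- A default colour: only elements below `L` have a value, and `avoids` compares only those.
      ... | no  _   = 0

      color-arc : ∀ {x} (x<L : x < L) → color x ≡ arc x<L
      color-arc {x} x<L with x <? L
      ... | yes x<L′ = cong arc (≤-irrelevant x<L′ x<L)
      ... | no  x≮L  = ⊥-elim (x≮L x<L)

      color<k : k > 0 → ∀ x → color x < k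
      color<k k>0 x with x <? L
      ... | yes x<L = m<n*o⇒m/o<n (subst (residue x<L * k <_) (*-comm M k)
                        (*-monoˡ-< k {{>-nonZero k>0}} (ℤ.n%ℕd<d (proj₁ (value x<L)) M)))
      ... | no  _   = k>0

      -- Equal quotients cancel, leaving a difference of two remainders modulo `M`. Stating the
      -- strict bound as at most `pred M` lets it be summed over the pairs.
      close : ∀ {x y} (x<L : x < L) (y<L : y < L) → color x ≡ color y →
        ℤ.∣ + residue x<L ℤ.- + residue y<L ∣ * k ≤ pred M
      close {x} {y} x<L y<L eq = ≤-pred (subst (ℤ.∣ + r ℤ.- + r′ ∣ * k <_) (sym (suc-pred M)) (begin-strict
        ℤ.∣ + r ℤ.- + r′ ∣ * k                                ≡⟨ ℤ.abs-* (+ r ℤ.- + r′) (+ k) ⟨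
        ℤ.∣ (+ r ℤ.- + r′) ℤ.* + k ∣                          ≡⟨ cong ℤ.∣_∣ same-quotient ⟩
        ℤ.∣ + (r * k % M) ℤ.- + (r′ * k % M) ∣                ≡⟨ cong ℤ.∣_∣ (ℤ.m-n≡m⊖n (r * k % M) (r′ * k % M)) ⟩
        ℤ.∣ (r * k % M) ℤ.⊖ (r′ * k % M) ∣                    ≤⟨ ℤ.∣m⊝n∣≤m⊔n (r * k % M) (r′ * k % M) ⟩
        (r * k % M) ⊔ (r′ * k % M)                            <⟨ ⊔-pres-<m (m%n<n (r * k) M) (m%n<n (r′ * k) M) ⟩
        M                                                     ∎))
        where
        open ≤-Reasoning
        r = residue x<L
        r′ = residue y<L
        split : ∀ m → + m ℤ.* + k ≡ + (m * k % M) ℤ.+ + (m * k / M) ℤ.* + M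
        split m = trans (sym (ℤ.pos-* m k)) (trans (cong +_ (m≡m%n+[m/n]*n (m * k) M))
          (cong (λ z → + (m * k % M) ℤ.+ z) (ℤ.pos-* (m * k / M) M)))
        arcs : r * k / M ≡ r′ * k / M
        arcs = trans (sym (color-arc x<L)) (trans eq (color-arc y<L))
        expand : ∀ s t c → (s ℤ.- t) ℤ.* c ≡ s ℤ.* c ℤ.- t ℤ.* c
        expand = solve-∀
        cancel : ∀ u u′ q → (u ℤ.+ q) ℤ.- (u′ ℤ.+ q) ≡ u ℤ.- u′
        cancel = solve-∀
        same-quotient : (+ r ℤ.- + r′) ℤ.* + k ≡ + (r * k % M) ℤ.- + (r′ * k % M)
        same-quotient = trans (expand (+ r) (+ r′) (+ k)) (trans
          (cong₂ ℤ._-_ (split r) (trans (split r′) (cong (λ q → + (r′ * k % M) ℤ.+ + q ℤ.* + M) (sym arcs))))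
          (cancel (+ (r * k % M)) (+ (r′ * k % M)) (+ (r * k / M) ℤ.* + M)))

      differences-small : ∀ i (x y : Vector ℕ i) → (∀ j → x j < L) → (∀ j → y j < L) →
        (∀ j → color (x j) ≡ color (y j)) →
        ∃ λ D → χ .Graph (sum (λ j → point (x j) - point (y j))) D × ℤ.∣ D ∣ * k ≤ i * pred M
      differences-small zero    x y x<L y<L eq = + 0 , 0-closed χ , z≤n
      differences-small (suc i) x y x<L y<L eq
        with differences-small i (x ∘ suc) (y ∘ suc) (x<L ∘ suc) (y<L ∘ suc) (eq ∘ suc)
      ... | D , r , D≤ = d ℤ.+ D ,
        χ .⊕-closed (χ .⊕-closed (residue-graph (x<L zero)) (χ .⊖-closed (residue-graph (y<L zero)))) r ,
        ≤-trans (*-monoˡ-≤ k (ℤ.∣i+j∣≤∣i∣+∣j∣ d D))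
          (≤-trans (≤-reflexive (*-distribʳ-+ k ℤ.∣ d ∣ ℤ.∣ D ∣))
            (+-mono-≤ (close (x<L zero) (y<L zero) (eq zero)) D≤))
        where d = + residue (x<L zero) ℤ.- + residue (y<L zero)

      -- A solution gives `b` a second value D with k|D| ≤ n(M - 1) < nM ≤ kv, so |D| < v. Both
      -- values agree modulo `M` and |D - v| < 2v ≤ M, which forces D = v, a contradiction.
      avoids : n > 0 → (x y : Vector ℕ n) → (∀ j → x j < L) → (∀ j → y j < L) →
        (∀ j → color (x j) ≡ color (y j)) → sum (λ j → point (x j) - point (y j)) ≢ b
      avoids n>0 x y x<L y<L eq sol with differences-small n x y x<L y<L eq
      ... | D , r , D≤ = <-irrefl (cong ℤ.∣_∣ D≡v) ∣D∣<v
        where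
        ∣D∣<v : ℤ.∣ D ∣ < v
        ∣D∣<v = *-cancelˡ-< k ℤ.∣ D ∣ v (subst (_< k * v) (*-comm ℤ.∣ D ∣ k)
          (≤-<-trans D≤ (<-≤-trans (*-monoʳ-< n {{>-nonZero n>0}} (≤-reflexive (suc-pred M))) (far .nM≤kv))))
        M∣ : M ∣ ℤ.∣ D ℤ.- + v ∣
        M∣ = ℤ.∣⇒∣ᵤ (single-valued′ χ (subst (λ y → χ .Graph y D) sol r) χb)
        small : ℤ.∣ D ℤ.- + v ∣ < M
        small = <-≤-trans (≤-<-trans (ℤ.∣i-j∣≤∣i∣+∣j∣ D (+ v)) (+-monoˡ-< v ∣D∣<v))
          (subst (λ w → v + w ≤ M) (+-identityʳ v) (far .2v≤M))
        D≡v : D ≡ + v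
        D≡v with ℤ.∣ D ℤ.- + v ∣ in eq′
        ... | zero  = ℤ.i-j≡0⇒i≡j D (+ v) (ℤ.∣i∣≡0⇒i≡0 eq′)
        ... | suc w = ⊥-elim (<⇒≱ (subst (_< M) eq′ small) (∣⇒≤ (subst (M ∣_) eq′ M∣)))

-- The distance of χ(b) from 0 and the number of colours

upperBound : ∀ {n} (x : Vector ℕ n) → ∃ λ B → ∀ j → x j ≤ B
upperBound {zero}  x = 0 , λ ()
upperBound {suc n} x with upperBound (x ∘ suc)
... | B , x≤B = x zero ⊔ B , λ { zero → m≤m⊔n (x zero) B ; (suc j) → ≤-trans (x≤B j) (m≤n⊔m (x zero) B) }

lengthBound : (σs : List (List Bool)) → ∃ λ L → ∀ {σ} → σ ∈ σs → length σ < L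
lengthBound []       = 0 , λ ()
lengthBound (τ ∷ σs) with lengthBound σs
... | L , <L = suc (length τ) ⊔ L , λ
  { (here refl) → m≤m⊔n (suc (length τ)) L ; (there σ∈) → ≤-trans (<L σ∈) (m≤n⊔m (suc (length τ)) L) }

∑<-threshold : ∀ s c → ∑< s (λ j → bit (j <ᵇ c)) ≡ s ⊓ c
∑<-threshold zero    c = refl
∑<-threshold (suc s) c with s <? c
... | yes s<c rewrite ∑<-threshold s c | bit-T (<⇒<ᵇ s<c) | m≤n⇒m⊓n≡m (<⇒≤ s<c) | m≤n⇒m⊓n≡m s<c = +-comm s 1
... | no  s≮c rewrite ∑<-threshold s c | bit-¬T (s≮c ∘ <ᵇ⇒< s c) | m≥n⇒m⊓n≡n (≮⇒≥ s≮c)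
                    | m≥n⇒m⊓n≡n (m≤n⇒m≤1+n (≮⇒≥ s≮c)) = +-identityʳ c

module _ (K : ℕ) .{{_ : NonZero K}} where

  -- A right inverse of decoding by `block`, for colours up to `K`: the block of an element starts
  -- with as many ones as its colour says.
  unaryBlocks : (ℕ → ℕ) → ℕ → Bool
  unaryBlocks col i = i % K <ᵇ col (i / K)

  block-unaryBlocks : ∀ col x → col x ≤ K → block K (bit ∘ unaryBlocks col) x ≡ col x
  block-unaryBlocks col x col≤K = trans
    (∑<-cong K λ j j<K → cong₂ (λ r q → bit (r <ᵇ col q))
      (trans ([m+kn]%n≡m%n j x K) (m<n⇒m%n≡m j<K))
      (trans (+-distrib-/-∣ʳ j (n∣m*n x)) (cong₂ _+_ (m<n⇒m/n≡0 j<K) (m*n/n≡m x K))))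
    (trans (∑<-threshold K (col x)) (m≥n⇒m⊓n≡n col≤K))

⌈/⌉-* : ∀ a d .{{_ : NonZero d}} → a ≤ ⌈ a / d ⌉ * d
⌈/⌉-* a d = +-cancelʳ-≤ (pred d) a _ (begin
  a + pred d                                    ≡⟨ m≡m%n+[m/n]*n (a + pred d) d ⟩
  (a + pred d) % d + ⌈ a / d ⌉ * d              ≤⟨ +-monoˡ-≤ _ (<⇒≤pred (m%n<n (a + pred d) d)) ⟩
  pred d + ⌈ a / d ⌉ * d                        ≡⟨ +-comm (pred d) _ ⟩
  ⌈ a / d ⌉ * d + pred d                        ∎)
  where open ≤-Reasoning

odd⇒≡1+2* : ∀ {p} → ¬ (2 ∣ p) → p ≡ suc (2 * (p / 2))
odd⇒≡1+2* {p} 2∤p with p % 2 in eq | m%n<n p 2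
... | 0 | _ = ⊥-elim (2∤p (m%n≡0⇒n∣m p 2 eq))
... | 1 | _ = trans (m≡m%n+[m/n]*n p 2) (cong₂ _+_ eq (*-comm (p / 2) 2))
... | suc (suc _) | s≤s (s≤s ())

far-half : ∀ n → Far n (2 * n) 2 1
far-half n = record
  { M>0 = z<s ; 2v≤M = ≤-refl ; nM≤kv = ≤-reflexive (trans (*-comm n 2) (sym (*-identityʳ (2 * n)))) }

-- As `p` is odd, `p / 2` is (p - 1)/2, and its quotient by `p` is a point of (1/p)ℤ/ℤ at the
-- greatest distance from 0. The number of colours is the least k with np ≤ k(p - 1)/2.
far-odd-prime : ∀ n {p} (p-prime : Prime p) → ¬ (2 ∣ p) →
  Far n (⌈ 2 * n * p / pred p ⌉ {{pred-nonZero p-prime}}) p (p / 2)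
far-odd-prime n {p} p-prime 2∤p = record
  { M>0   = subst (_> 0) (sym p≡) z<s
  ; 2v≤M  = ≤-trans (n≤1+n _) (≤-reflexive (sym p≡))
  ; nM≤kv = *-cancelˡ-≤ 2 (begin
      2 * (n * p)          ≡⟨ *-assoc 2 n p ⟨
      2 * n * p            ≤⟨ ⌈/⌉-* (2 * n * p) (pred p) {{pred-nonZero p-prime}} ⟩
      k * pred p           ≡⟨ cong (λ q → k * pred q) p≡ ⟩
      k * (2 * (p / 2))    ≡⟨ x∙yz≈y∙xz k 2 (p / 2) ⟩
      2 * (k * (p / 2))    ∎) }
  where
  open ≤-Reasoning
  p≡ = odd⇒≡1+2* 2∤p
  k = ⌈ 2 * n * p / pred p ⌉ {{pred-nonZero p-prime}}

-- No distance from 0 exceeds 1/2, so n/k ≤ 1/2. This excludes k = 0 and k = 1, so that blocks of k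
-- - 1 bits are nonempty.
far⇒2n≤k : ∀ {n k M v} → n > 0 → Far n k M v → 2 * n ≤ k
far⇒2n≤k {n} {k} {M} {zero} n>0 far =
  ⊥-elim (<⇒≱ (*-mono-≤ n>0 (Far.M>0 far)) (subst (n * M ≤_) (*-zeroʳ k) (Far.nM≤kv far)))
far⇒2n≤k {n} {k} {M} {v@(suc _)} n>0 far = *-cancelʳ-≤ (2 * n) k v (begin
  2 * n * v      ≡⟨ cong (_* v) (*-comm 2 n) ⟩
  n * 2 * v      ≡⟨ *-assoc n 2 v ⟩
  n * (2 * v)    ≤⟨ *-monoʳ-≤ n (Far.2v≤M far) ⟩
  n * M          ≤⟨ Far.nM≤kv far ⟩
  k * v          ∎)
  where open ≤-Reasoning

-- From characters to an infinite tree, and from its paths to colourings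

module _ (G : ComputableAbelianGroup) where
  open ComputableAbelianGroup G
  open Characters isAbelianGroup using (multiple-of-least; trivial; Stage; stages; stage-zero; module ArcColoring)
  open AbelianGroup abelianGroup using (identityˡ; monoid)
  open MonoidSum monoid using (sum-cong-≗)

  -- The trivial character has domain {0}, so the least positive multiple of `b` meeting it is given
  -- by the order, and `multiple-of-least` applies.
  order-∣ : ∀ {b m} → HasOrder b m → ∀ w → w · b ≡ 0# → m ∣ w
  order-∣ {b} (m>0 , m·b≡0 , least) w w·b≡0
    with multiple-of-least (trivial 1) b m>0 (m·b≡0 , 1∣0)
           (λ {i} i<m (i>0 , _ , i·b≡0 , _) → <⇒≱ i<m (least i i>0 i·b≡0)) w (w·b≡0 , 1∣0)
    where
    1∣0 : + 1 ℤ.∣ + 0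
    1∣0 = ℤ.divides (+ 0) refl
  ... | q , w≡q*m , _ = divides q w≡q*m

  far-annihilated : ∀ {n b k} → NumberOfColors G n b k →
    ∃ λ M → ∃ λ v → Far n k M v × (∀ w → w · b ≡ 0# → M ∣ w)
  far-annihilated {n} (even-order order 2∣m) =
    2 , 1 , far-half n , λ w w·b≡0 → ∣-trans 2∣m (order-∣ order w w·b≡0)
  far-annihilated {n} {b} (infinite-order infinite) = 2 , 1 , far-half n , annihilates
    where
    annihilates : ∀ w → w · b ≡ 0# → 2 ∣ w
    annihilates zero    _      = 2 ∣0
    annihilates (suc w) w·b≡0 = ⊥-elim (infinite (suc w) z<s w·b≡0)
  far-annihilated {n} (odd-order {p = p} order 2∤m (p-prime , p∣m , _)) =
    p , p / 2 , far-odd-prime n p-prime (λ 2∣p → 2∤m (∣-trans 2∣p p∣m)) ,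
    λ w w·b≡0 → ∣-trans p∣m (order-∣ order w w·b≡0)

  module _ (n : ℕ) (n>0 : n > 0) (b : Carrier) (K : ℕ) {{_ : NonZero K}} where

    private
      tree = avoidanceTree G b K n
      open ComputableBinaryTree tree using (member)

    block<1+K : ∀ (f : ℕ → Bool) x → block K (bit ∘ f) x < suc K
    block<1+K f x = s≤s (∑<-bits K _)

    block-applyUpTo : ∀ f L x → K + x * K < L → block K (bitAt ⌜ applyUpTo f L ⌝) x ≡ block K (bit ∘ f) x
    block-applyUpTo f L x x< = block-cong K {x = x} λ i i< → bitAt-applyUpTo f L (<-trans i< x<)

    stage-member : ∀ {L} → Stage n (suc K) (point G) b L → ∃ λ σ → length σ ≡ L × T (member σ)
    stage-member {L} stage = σ , length-applyUpTo f L ,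
      ≡⇒≡ᵇ _ 0 (solutions≡0⇐ G b K σ n 0# λ x y same≢0 sol →
        avoids n>0 x y (λ j → bounded (x j) (known x y same≢0 j)) (λ j → bounded (y j) (known′ x y same≢0 j))
          (λ j → trans (sym (decoded (x j) (known x y same≢0 j)))
            (trans (proj₂ (proj₂ (same≢0⇒ K σ (x j) (y j) (same≢0 j))))
              (decoded (y j) (known′ x y same≢0 j))))
          (trans (sym (identityˡ _)) sol))
      where
      open ArcColoring n (suc K) (point G) b stage
      f = unaryBlocks K color
      σ = applyUpTo f L
      Same≢0 = λ (x y : Vector ℕ n) → ∀ j → same K ⌜ σ ⌝ (x j) (y j) ≢ 0
      known : ∀ x y → Same≢0 x y → ∀ j → K + x j * K < L
      known x y same≢0 j = subst (K + x j * K <_) (length-applyUpTo f L) (proj₁ (same≢0⇒ K σ (x j) (y j) (same≢0 j)))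
      known′ : ∀ x y → Same≢0 x y → ∀ j → K + y j * K < L
      known′ x y same≢0 j = subst (K + y j * K <_) (length-applyUpTo f L) (proj₁ (proj₂ (same≢0⇒ K σ (x j) (y j) (same≢0 j))))
      -- A string of length `L` has complete blocks only for elements below `L`, and the stage has
      -- values for all of those.
      bounded : ∀ x → K + x * K < L → x < L
      bounded x = ≤-<-trans (≤-trans (m≤m*n x K) (m≤n+m _ K))
      decoded : ∀ x → K + x * K < L → block K (bitAt ⌜ σ ⌝) x ≡ color x
      decoded x x< = trans (block-applyUpTo f L x x<) (block-unaryBlocks K color x (≤-pred (color<k z<s x)))

    avoidanceTree-infinite : Stage n (suc K) (point G) b 0 → Infinite tree
    avoidanceTree-infinite stage₀ σs with lengthBound σs
    ... | L , <L with string? member L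
    ...   | yes (σ , refl , t) = σ , t , λ σ∈ → <-irrefl refl (<L σ∈)
    -- Membership at level `L` was decided by finite search, so the double negation of a stage
    -- suffices to refute emptiness.
    ...   | no  none           = ⊥-elim (stages n (suc K) (point G) b stage₀ L (none ∘ stage-member))

    module _ (f : ℕ → Bool) where

      pathColoring : Coloring (suc K)
      pathColoring x = fromℕ< (block<1+K f (proj₁ x))

      pathColoring-computable : ∀ {X} → ComputableIn X (λ m → m ∷ []) (bit ∘ f) → ColoringComputableIn X pathColoring
      pathColoring-computable cf = computable-resp (λ x → sym (toℕ-fromℕ< (block<1+K f (proj₁ x))))
        (block-computable K (compose₁ cf (variable-computable zero)) (variable-computable zero))

      path-avoids : IsPath tree f →
        ¬ (∃ λ x → ∃ λ y → IsSolution b x y × PairwiseMonochromatic {n = n} pathColoring x y)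
      path-avoids path (x , y , sol , mono) =
        solutions≡0⇒ G b K (applyUpTo f L) n 0# (≡ᵇ⇒≡ _ 0 (path L)) (proj₁ ∘ x) (proj₁ ∘ y)
          (λ j → same≢0⇐ K (applyUpTo f L) (proj₁ (x j)) (proj₁ (y j)) (inside (x≤ j)) (inside (y≤ j))
            (trans (decoded _ (x≤ j)) (trans (color≡ j) (sym (decoded _ (y≤ j))))))
          (trans (identityˡ _) (trans
            (sum-cong-≗ λ j → cong₂ _-_ (point-proj₁ G (x j)) (point-proj₁ G (y j))) sol))
        where
        Bx = upperBound (proj₁ ∘ x)
        By = upperBound (proj₁ ∘ y)
        B = proj₁ Bx ⊔ proj₁ By
        -- The least length at which the block of `B` counts as complete, and with it the blocks of
        -- all entries of the solution.
        L = suc (K + B * K)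
        x≤ : ∀ j → proj₁ (x j) ≤ B
        x≤ j = ≤-trans (proj₂ Bx j) (m≤m⊔n (proj₁ Bx) (proj₁ By))
        y≤ : ∀ j → proj₁ (y j) ≤ B
        y≤ j = ≤-trans (proj₂ By j) (m≤n⊔m (proj₁ Bx) (proj₁ By))
        below : ∀ {m} → m ≤ B → K + m * K < L
        below m≤B = s≤s (+-monoʳ-≤ K (*-monoˡ-≤ K m≤B))
        inside : ∀ {m} → m ≤ B → K + m * K < length (applyUpTo f L)
        inside {m} m≤B = subst (K + m * K <_) (sym (length-applyUpTo f L)) (below m≤B)
        decoded : ∀ m → m ≤ B → block K (bitAt ⌜ applyUpTo f L ⌝) m ≡ block K (bit ∘ f) m
        decoded m m≤B = block-applyUpTo f L m (below m≤B)
        color≡ : ∀ j → block K (bit ∘ f) (proj₁ (x j)) ≡ block K (bit ∘ f) (proj₁ (y j))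
        color≡ j = trans (sym (toℕ-fromℕ< (block<1+K f (proj₁ (x j)))))
          (trans (cong toℕ (mono j)) (toℕ-fromℕ< (block<1+K f (proj₁ (y j)))))

  far⇒avoidingColoring : ∀ {n b k M v} → n > 0 → Far n k M v → (∀ w → w · b ≡ 0# → M ∣ w) →
    AvoidingColoringOfPADegree G n b k
  far⇒avoidingColoring {k = 0} n>0 far _ = ⊥-elim (<⇒≱ (*-monoʳ-< 2 n>0) (far⇒2n≤k n>0 far))
  far⇒avoidingColoring {k = 1} n>0 far _ = ⊥-elim (<⇒≱ (*-monoʳ-≤ 2 n>0) (far⇒2n≤k n>0 far))
  far⇒avoidingColoring {n} {b} {suc K@(suc _)} n>0 far annihilates X pa
    with pa (avoidanceTree G b K n)
           (avoidanceTree-infinite n n>0 b K (stage-zero n (suc K) (point G) b far annihilates))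
  ... | f , path , cf =
    pathColoring n n>0 b K f , pathColoring-computable n n>0 b K f cf , path-avoids n n>0 b K f path

proposition3p0p7 : (n : ℕ) → n > 0 →
    (G : ComputableAbelianGroup) → let open ComputableAbelianGroup G in
    (b : Carrier) → b ≢ 0# →
    (k : ℕ) → NumberOfColors G n b k →
    AvoidingColoringOfPADegree G n b k
proposition3p0p7 n n>0 G b _ k colors with far-annihilated G colors
... | M , v , far , annihilates = far⇒avoidingColoring G n>0 far annihilates
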